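{- For any integer $k\ge1$ and any 2-connected outerplanar graph $G$ with maximum degree $\Delta(G)\ge7$, we have $\mathit{ch}_k(G)\le\bigl\lfloor\frac{\Delta(G)-2}{k}\bigr\rfloor+3$.
   Context: All graphs are finite and simple. An outerplanar graph is a graph that can be drawn in the plane so that all vertices lie on the outer face. For an integer $k\ge1$, a $k$-frugal colouring of $G$ is a proper vertex colouring such that no colour appears more than $k$ times in the neighbourhood of any vertex. A $t$-list assignment $L$ assigns to each vertex $v$ a list $L(v)$ of $t$ integers; $\mathit{ch}_k(G)$ is the least $t$ such that for every $t$-list assignment $L$ there is a $k$-frugal colouring with each vertex $v$ coloured from $L(v)$. -}

module Defs where

open import Data.Nat using (ℕ; zero; suc; _+_; _≤_; _<_; _⊔_)
open import Data.Fin using (Fin; toℕ)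
open import Data.Bool using (Bool; true; false; if_then_else_; _∧_)
open import Data.Integer using (ℤ)
import Data.Integer as ℤ
open import Data.List using (List; length; foldr; map; allFin)
open import Data.List.Membership.Propositional using (_∈_)
open import Data.List.Relation.Unary.Unique.Propositional using (Unique)
open import Data.Product using (Σ; _×_)
open import Data.Empty using (⊥)
open import Relation.Nullary using (¬_)
open import Relation.Nullary.Decidable using (⌊_⌋)
open import Relation.Binary.PropositionalEquality using (_≡_; _≢_)

Σ[_]_ : (n : ℕ) → (Fin n → ℕ) → ℕ
Σ[ n ] f = foldr _+_ 0 (map f (allFin n))

record Graph (n : ℕ) : Set where
  field
    adj    : Fin n → Fin n → Bool
    sym    : ∀ u v → adj u v ≡ adj v u
    irrefl : ∀ v → adj v v ≡ false
open Graph public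

Adj : ∀ {n} → Graph n → Fin n → Fin n → Set
Adj G u v = adj G u v ≡ true

deg : ∀ {n} → Graph n → Fin n → ℕ
deg {n} G v = Σ[ n ] (λ u → if adj G v u then 1 else 0)

maxDeg : ∀ {n} → Graph n → ℕ
maxDeg {n} G = foldr _⊔_ 0 (map (deg G) (allFin n))

data Reach {n} (G : Graph n) (removed : Fin n → Set) : Fin n → Fin n → Set where
  here : ∀ {u} → Reach G removed u u
  step : ∀ {u w v} → Adj G u w → ¬ removed w → Reach G removed w v → Reach G removed u v

Connected : ∀ {n} → Graph n → Set
Connected {n} G = ∀ (u v : Fin n) → Reach G (λ _ → ⊥) u v

TwoConnected : ∀ {n} → Graph n → Set
TwoConnected {n} G =
  2 < n × Connected G ×
  (∀ (x u v : Fin n) → u ≢ x → v ≢ x → Reach G (λ w → w ≡ x) u v)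

-- G is outerplanar: the vertices can be placed in distinct positions on a circle
-- (an injective position map into Fin n) so that no two edges, drawn as chords,
-- cross; chords {a,b},{c,d} cross iff pos a < pos c < pos b < pos d
-- (for some orientation/ordering of the two edges).
Outerplanar : ∀ {n} → Graph n → Set
Outerplanar {n} G =
  Σ (Fin n → Fin n) λ pos →
    (∀ u v → pos u ≡ pos v → u ≡ v) ×
    (∀ a b c d → Adj G a b → Adj G c d →
       ¬ (toℕ (pos a) < toℕ (pos c) × toℕ (pos c) < toℕ (pos b) × toℕ (pos b) < toℕ (pos d)))

nbrCount : ∀ {n} → Graph n → (Fin n → ℤ) → Fin n → ℤ → ℕ
nbrCount {n} G c v a = Σ[ n ] (λ u → if adj G v u ∧ ⌊ c u ℤ.≟ a ⌋ then 1 else 0)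

Frugal : ∀ {n} → Graph n → ℕ → (Fin n → ℤ) → Set
Frugal {n} G k c =
  (∀ u v → Adj G u v → c u ≢ c v) ×
  (∀ v a → nbrCount G c v a ≤ k)

ListAssignment : ℕ → ℕ → Set
ListAssignment n t = Σ (Fin n → List ℤ) λ L → ∀ v → Unique (L v) × length (L v) ≡ t

FrugalChoosable : ∀ {n} → Graph n → ℕ → ℕ → Set
FrugalChoosable {n} G k t =
  (L : ListAssignment n t) →
  Σ (Fin n → ℤ) λ c → (∀ v → c v ∈ Data.Product.proj₁ L v) × Frugal G k c

-- ch_k(G) ≤ m  (ch_k(G) is the least t with FrugalChoosable G k t)
ChkAtMost : ∀ {n} → Graph n → ℕ → ℕ → Set
ChkAtMost G k m = Σ ℕ λ t → t ≤ m × FrugalChoosable G k t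

{-# OPTIONS --safe #-}
-- Put d = Δ − 2 ≥ 5 and place the vertices on a circle. By 2-connectedness,
-- circularly consecutive vertices are adjacent. The key point is that some vertex u
-- of degree two, with neighbours v and w, has at most d vertices other than u, v, w
-- in N(v) ∪ N(w). Delete u, join v to w (no degree grows) and colour the rest by
-- induction. The colours forbidden at u are those of v and w and the at most ⌊d/k⌋
-- colours that occur k times among those d vertices, so a list of length ⌊d/k⌋ + 3
-- has a free colour.
--
-- To find u, climb the tree of inner faces. Unless u has been found on the outer side
-- of a chord xy, that side is empty, is a triangle, or contains a, b ≤ 2
-- neighbours of x and y respectively and yields u once deg x ≤ 4 + a or deg y ≤ 4 + b. An end of a
-- chord that is interior to the next face always satisfies this degree bound, so the
-- third alternative never survives to the next level, and a face all of whose chords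
-- are of the first two kinds has at most four sides or yields u.
module Submission where

open import Defs hiding (sym)
open import Data.Nat hiding (z<s)
open import Data.Nat.Properties
open import Data.Nat.DivMod using (_/_; /-monoˡ-≤; m*n/n≡m)
open import Data.Bool using (Bool; true; false; if_then_else_; _∧_)
import Data.Bool.Properties as Bool
open import Data.Fin as Fin using (Fin; toℕ; fromℕ; punchOut)
import Data.Fin.Properties as Fin
open import Data.Integer as ℤ using (ℤ)
open import Data.List using (List; []; _∷_; length; filter; map; foldr; allFin; _++_)
open import Data.List.Properties using (length-++; length-map; length-tabulate; filter-notAll; filter-all)
open import Data.List.Membership.Propositional using (_∈_; find)
open import Data.List.Membership.Propositional.Properties
  using (∈-++⁺ˡ; ∈-++⁺ʳ; ∈-filter⁺; ∈-filter⁻; ∈-map⁺; ∈-map⁻; ∈-allFin)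
open import Data.List.Relation.Unary.Any as Any using (here; there; any?)
open import Data.List.Relation.Unary.All as All using (All; []; _∷_)
open import Data.List.Relation.Unary.All.Properties using (¬Any⇒All¬)
open import Data.List.Relation.Unary.AllPairs using ([]; _∷_)
open import Data.List.Relation.Unary.Unique.Propositional using (Unique)
import Data.List.Relation.Unary.Unique.Propositional.Properties as Unique
open import Data.Product using (Σ; ∃; _×_; _,_; proj₁; proj₂)
open import Data.Sum using (_⊎_; inj₁; inj₂; [_,_]′)
open import Data.Empty using (⊥; ⊥-elim)
open import Function using (id)
open import Relation.Nullary using (¬_; Dec; yes; no; contradiction)
open import Relation.Nullary.Decidable using (¬?; _×-dec_; _⊎-dec_; ⌊_⌋)
open import Relation.Binary using (tri<; tri≈; tri>)
open import Relation.Unary using (Decidable)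
open import Relation.Binary.PropositionalEquality
  using (_≡_; _≢_; refl; sym; trans; cong; subst; subst₂; ≢-sym)

-- Cardinality bounds by covering lists

Cov : (ℕ → Set) → ℕ → Set
Cov P m = Σ (List ℕ) λ l → length l ≤ m × (∀ {z} → P z → z ∈ l)

module _ {P Q : ℕ → Set} where

  cov-⊆ : ∀ {m} → (∀ {z} → P z → Q z) → Cov Q m → Cov P m
  cov-⊆ f (l , len , cov) = l , len , λ p → cov (f p)

  cov-∪ : ∀ {m n} → Cov P m → Cov Q n → Cov (λ z → P z ⊎ Q z) (m + n)
  cov-∪ {m} {n} (l , len , cov) (l′ , len′ , cov′) =
    l ++ l′ , subst (_≤ m + n) (sym (length-++ l)) (+-mono-≤ len len′) ,
    [ (λ p → ∈-++⁺ˡ (cov p)) , (λ q → ∈-++⁺ʳ l (cov′ q)) ]′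

cov-≤ : ∀ {P m n} → m ≤ n → Cov P m → Cov P n
cov-≤ m≤n (l , len , cov) = l , ≤-trans len m≤n , cov

cov-∖ : ∀ {P m u} → P u → Cov P (suc m) → Cov (λ z → P z × z ≢ u) m
cov-∖ {u = u} pu (l , len , cov) =
  filter (λ z → ¬? (z ≟ u)) l ,
  ≤-pred (≤-trans (filter-notAll _ l (Any.map (λ { refl ne → ne refl }) (cov pu))) len) ,
  λ { (p , ne) → ∈-filter⁺ _ (cov p) ne }

cov-≡ : ∀ u → Cov (_≡ u) 1
cov-≡ u = u ∷ [] , ≤-refl , λ { refl → here refl }

cov-∅ : ∀ {P : ℕ → Set} → (∀ {z} → ¬ P z) → Cov P 0
cov-∅ none = [] , z≤n , λ p → ⊥-elim (none p)

-- Bounded search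

module _ {P : ℕ → Set} (P? : Decidable P) where

  private
    extend-none : ∀ {n} → (∀ {w} → w < n → ¬ P w) → ¬ P n → ∀ {w} → w < suc n → ¬ P w
    extend-none none ¬pn w<1+n pw with m≤n⇒m<n∨m≡n (≤-pred w<1+n)
    ... | inj₁ w<n = none w<n pw
    ... | inj₂ refl = ¬pn pw

  least : ∀ n → (∃ λ m → m < n × P m × (∀ {w} → P w → m ≤ w)) ⊎ (∀ {w} → w < n → ¬ P w)
  least zero = inj₂ λ ()
  least (suc n) with least n
  ... | inj₁ (m , m<n , pm , min) = inj₁ (m , m≤n⇒m≤1+n m<n , pm , min)
  ... | inj₂ none with P? n
  ... | yes pn = inj₁ (n , ≤-refl , pn , λ pw → ≮⇒≥ λ w<n → none w<n pw)
  ... | no ¬pn = inj₂ (extend-none none ¬pn)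

  greatest : ∀ n → (∃ λ m → m < n × P m × (∀ {w} → w < n → P w → w ≤ m)) ⊎
             (∀ {w} → w < n → ¬ P w)
  greatest zero = inj₂ λ ()
  greatest (suc n) with P? n
  ... | yes pn = inj₁ (n , ≤-refl , pn , λ w<1+n _ → ≤-pred w<1+n)
  ... | no ¬pn with greatest n
  ... | inj₁ (m , m<n , pm , max) = inj₁ (m , m≤n⇒m≤1+n m<n , pm , λ w<1+n pw →
          [ (λ w<n → max w<n pw) , (λ { refl → contradiction pw ¬pn }) ]′
            (m≤n⇒m<n∨m≡n (≤-pred w<1+n)))
  ... | inj₂ none = inj₂ (extend-none none ¬pn)

-- Outerplanar graphs as polygons with non-crossing chords

-- V need not contain every number up to N: deleting a vertex leaves a gap instead of
-- renumbering, and `adjacent` refers to vertices that are consecutive in V.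
record Polygon (N : ℕ) : Set₁ where
  field
    V         : ℕ → Set
    V?        : Decidable V
    E         : ℕ → ℕ → Set
    E?        : ∀ a b → Dec (E a b)
    E-sym     : ∀ {a b} → E a b → E b a
    E-irrefl  : ∀ {a} → ¬ E a a
    E⇒V       : ∀ {a b} → E a b → V a
    V⇒≤       : ∀ {z} → V z → z ≤ N
    base      : E 0 N
    planar    : ∀ {a b c d} → E a b → E c d → a < c → c < b → b < d → ⊥
    adjacent  : ∀ {x y} → V x → V y → x < y → (∀ {z} → V z → x < z → z < y → ⊥) → E x y

  E⇒Vʳ : ∀ {a b} → E a b → V b
  E⇒Vʳ e = E⇒V (E-sym e)

  In : ℕ → ℕ → ℕ → ℕ → Set
  In c x y z = E c z × x < z × z < y

  Empty : ℕ → ℕ → Set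
  Empty x y = ∀ {z} → V z → x < z → z < y → ⊥

  -- Besides degree two of `u`, `lonely` ensures that `v` and `w` become consecutive once `u` is
  -- gone, so that they can be joined without a crossing.
  record Ear (v u w : ℕ) : Set where
    constructor ear
    field
      v<u    : v < u
      u<w    : u < w
      vu     : E v u
      uw     : E u w
      lonely : ∀ {z} → V z → v < z → z < w → z ≡ u
      nbrs   : ∀ {z} → E u z → z ≡ v ⊎ z ≡ w

  Far : ℕ → ℕ → ℕ → ℕ → Set
  Far v u w z = (E v z ⊎ E w z) × z ≢ u × z ≢ v × z ≢ w

  Good : ℕ → Set
  Good d = ∃ λ v → ∃ λ u → ∃ λ w → Ear v u w × Cov (Far v u w) d

-- Existence of a reducible vertex of degree two

module Structure {N} (P : Polygon N) (d : ℕ) (5≤d : 5 ≤ d)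
                 (degree : ∀ v → Cov (Polygon.E P v) (2 + d)) where
  open Polygon P

  -- Lets the end called `v` lie on either side of `u`, so that mirror images share one argument.
  Ear± : ℕ → ℕ → ℕ → Set
  Ear± v u w = Ear v u w ⊎ Ear w u v

  Ear±⇒E : ∀ {v u w} → Ear± v u w → E v u
  Ear±⇒E (inj₁ e) = Ear.vu e
  Ear±⇒E (inj₂ e) = E-sym (Ear.uw e)

  good± : ∀ {v u w} → Ear± v u w → Cov (Far v u w) d → Good d
  good± (inj₁ e) cov = _ , _ , _ , e , cov
  good± (inj₂ e) cov = _ , _ , _ , e ,
    cov-⊆ (λ { (e′ , ne , nv , nw) → [ inj₂ , inj₁ ]′ e′ , ne , nw , nv }) cov

  -- Both `u` and `w` are discounted from the neighbours of `v`, leaving `i`; whatever `w` sees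
  -- beyond those lies in `X`.
  good-triangle : ∀ {v u w i j X} → Ear± v u w → E v w → Cov (E v) (2 + i) →
    (∀ {z} → E w z → z ≡ v ⊎ z ≡ u ⊎ E v z ⊎ X z) → Cov X j → i + j ≤ d → Good d
  good-triangle {v} {u} {w} {X = X} e vw covE split covX i+j≤d = good± e (cov-≤ i+j≤d
    (cov-⊆ far (cov-∪ (cov-∖ (Ear±⇒E e , λ { refl → E-irrefl (wu e) }) (cov-∖ vw covE)) covX)))
    where
    wu : ∀ {u} → Ear± v u w → E u w
    wu (inj₁ e) = Ear.uw e
    wu (inj₂ e) = E-sym (Ear.vu e)
    far : ∀ {z} → Far v u w z → ((E v z × z ≢ w) × z ≢ u) ⊎ X z
    far (inj₁ vz , nu , nv , nw) = inj₁ ((vz , nw) , nu)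
    far (inj₂ wz , nu , nv , nw) with split wz
    ... | inj₁ eq = contradiction eq nv
    ... | inj₂ (inj₁ eq) = contradiction eq nu
    ... | inj₂ (inj₂ (inj₁ vz)) = inj₁ ((vz , nw) , nu)
    ... | inj₂ (inj₂ (inj₂ xz)) = inj₂ xz

  -- Here `v` and `w` need not be adjacent, so only `u` is discounted and the bound on the degree of
  -- `v` must be one smaller.
  good-path : ∀ {v u w i j X} → Ear± v u w → Cov (E v) (1 + i) →
    (∀ {z} → E w z → z ≡ u ⊎ E v z ⊎ X z) → Cov X j → i + j ≤ d → Good d
  good-path {v} {u} {w} {X = X} e covE split covX i+j≤d = good± e (cov-≤ i+j≤d
    (cov-⊆ far (cov-∪ (cov-∖ (Ear±⇒E e) covE) covX)))
    where
    far : ∀ {z} → Far v u w z → (E v z × z ≢ u) ⊎ X z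
    far (inj₁ vz , nu , _) = inj₁ (vz , nu)
    far (inj₂ wz , nu , _) with split wz
    ... | inj₁ eq = contradiction eq nu
    ... | inj₂ (inj₁ vz) = inj₁ (vz , nu)
    ... | inj₂ (inj₂ xz) = inj₂ xz

  data Plain (x y : ℕ) : Set where
    edge : Empty x y → Plain x y
    tri  : ∀ u → V u → x < u → u < y → (∀ {z} → V z → x < z → z < y → z ≡ u) → Plain x y

  data Kind (x y : ℕ) : Set where
    plain : Plain x y → Kind x y
    -- The 4 is what a chord end interior to the next face sees elsewhere: two face neighbours and,
    -- under its other side, at most two more; hence the cap of 2 on `a` and `b`.
    cond  : ∀ a b → a ≤ 2 → b ≤ 2 → Cov (In x x y) a → Cov (In y x y) b →
            (Cov (E x) (4 + a) → Good d) → (Cov (E y) (4 + b) → Good d) → Kind x y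

  size : ∀ {x y} → Plain x y → ℕ
  size (edge _) = 0
  size (tri _ _ _ _ _) = 1

  size≤1 : ∀ {x y} (κ : Plain x y) → size κ ≤ 1
  size≤1 (edge _) = z≤n
  size≤1 (tri _ _ _ _ _) = ≤-refl

  cov-plain : ∀ {x y c} (κ : Plain x y) → Cov (In c x y) (size κ)
  cov-plain (edge empty) = cov-∅ λ { (e , x<z , z<y) → empty (E⇒Vʳ e) x<z z<y }
  cov-plain (tri u _ _ _ only) = cov-⊆ (λ { (e , x<z , z<y) → only (E⇒Vʳ e) x<z z<y }) (cov-≡ u)

  cov-left : ∀ {x y} → Kind x y → Cov (In x x y) 2
  cov-left (plain κ) = cov-≤ (≤-trans (size≤1 κ) (s≤s z≤n)) (cov-plain κ)
  cov-left (cond _ _ a≤2 _ cov _ _ _) = cov-≤ a≤2 cov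

  cov-right : ∀ {x y} → Kind x y → Cov (In y x y) 2
  cov-right (plain κ) = cov-≤ (≤-trans (size≤1 κ) (s≤s z≤n)) (cov-plain κ)
  cov-right (cond _ _ _ b≤2 _ cov _ _) = cov-≤ b≤2 cov

  triangle-ear : ∀ {x y u} → E x y → V u → x < u → u < y →
    (∀ {z} → V z → x < z → z < y → z ≡ u) → Ear x u y
  triangle-ear {x} {y} {u} xy vu x<u u<y only = ear x<u u<y
    (adjacent (E⇒V xy) vu x<u λ vz x<z z<u → <⇒≢ z<u (only vz x<z (<-trans z<u u<y)))
    (adjacent vu (E⇒Vʳ xy) u<y λ vz u<z z<y → >⇒≢ u<z (only vz (<-trans x<u u<z) z<y))
    only nb
    where
    nb : ∀ {z} → E u z → z ≡ x ⊎ z ≡ y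
    nb {z} uz with <-cmp z x | <-cmp z y
    ... | tri< z<x _ _ | _ = ⊥-elim (planar (E-sym uz) xy z<x x<u u<y)
    ... | tri≈ _ eq _ | _ = inj₁ eq
    ... | tri> _ _ x<z | tri< z<y _ _ = ⊥-elim (E-irrefl (subst (E u) (only (E⇒Vʳ uz) x<z z<y) uz))
    ... | tri> _ _ x<z | tri≈ _ eq _ = inj₂ eq
    ... | tri> _ _ x<z | tri> _ _ y<z = ⊥-elim (planar xy uz x<u u<y y<z)

  -- The inner face at a chord

  module Chord {x y : ℕ} (x<y : x < y) (xy : E x y) where

    -- Consecutive vertices of the inner face at the chord xy, walked from x to y.
    record Next (q p : ℕ) : Set where
      constructor next
      field
        qp  : E q p
        q<p : q < p
        p≤y : p ≤ y
        -- `p` is the last neighbour of `q` up to `y`, the chord being exempt: otherwise the walk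
        -- from `x` would jump straight to `y`.
        top : ∀ {z} → E q z → p < z → z ≤ y → q ≡ x × z ≡ y

    -- The invariant that keeps the walk on the inner face: only the chord itself may pass over `q`.
    Sep : ℕ → Set
    Sep q = ∀ {z w} → E z w → x ≤ z → z < q → q < w → w ≤ y → z ≡ x × w ≡ y

    sep-x : Sep x
    sep-x _ x≤z z<x _ _ = contradiction x≤z (<⇒≱ z<x)

    -- An edge over `p` that starts before `q` also passes over `q`, one from `q` is governed by
    -- `top`, and one from between `q` and `p` crosses `qp`.
    sep-next : ∀ {q p} → Sep q → Next q p → Sep p
    sep-next {q} sep (next qp q<p p≤y top) {z} zw x≤z z<p p<w w≤y with <-cmp z q
    ... | tri< z<q _ _ = sep zw x≤z z<q (<-trans q<p p<w) w≤y
    ... | tri≈ _ refl _ = top zw p<w w≤y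
    ... | tri> _ _ q<z = ⊥-elim (planar qp zw q<z z<p p<w)

    record Inner (q p s : ℕ) : Set where
      constructor inner
      field
        x≤q : x ≤ q
        p<y : p < y
        sep : Sep q
        qp! : Next q p
        ps! : Next p s
      open Next qp! public using (qp; q<p)
      open Next ps! public using (top) renaming (qp to ps; q<p to p<s)
      x<p : x < p
      x<p = ≤-<-trans x≤q q<p

    -- Any other neighbour would give an edge crossing `xy`, an edge over `q` against `Sep`, or a
    -- neighbour past `s` against `top`.
    nbrs : ∀ {q p s z} → Inner q p s → E p z → z ≡ q ⊎ z ≡ s ⊎ In p q p z ⊎ In p p s z
    nbrs {q} {p} {s} {z} I pz with <-cmp z q | <-cmp z p | <-cmp z s
    ... | tri≈ _ eq _ | _ | _ = inj₁ eq
    ... | _ | _ | tri≈ _ eq _ = inj₂ (inj₁ eq)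
    ... | _ | tri≈ _ refl _ | _ = ⊥-elim (E-irrefl pz)
    ... | tri> _ _ q<z | tri< z<p _ _ | _ = inj₂ (inj₂ (inj₁ (pz , q<z , z<p)))
    ... | _ | tri> _ _ p<z | tri< z<s _ _ = inj₂ (inj₂ (inj₂ (pz , p<z , z<s)))
    ... | tri< z<q _ _ | tri< z<p _ _ | _ with x ≤? z
    ...   | yes x≤z = contradiction (proj₂ (sep (E-sym pz) x≤z z<q q<p (<⇒≤ p<y))) (<⇒≢ p<y)
      where open Inner I
    ...   | no x≰z = ⊥-elim (planar (E-sym pz) xy (≰⇒> x≰z) x<p p<y)
      where open Inner I
    nbrs {q} {p} {s} {z} I pz | _ | tri> _ _ p<z | tri> _ _ s<z with z ≤? y
    ... | yes z≤y = contradiction (sym (proj₁ (top pz s<z z≤y))) (<⇒≢ x<p)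
      where open Inner I
    ... | no z≰y = ⊥-elim (planar xy pz x<p p<y (≰⇒> z≰y))
      where open Inner I

    cov-nbrs : ∀ {q p s m n} → Inner q p s → Cov (In p q p) m → Cov (In p p s) n →
               Cov (E p) (2 + (m + n))
    cov-nbrs I c c′ = cov-⊆ (nbrs I) (cov-∪ (cov-≡ _) (cov-∪ (cov-≡ _) (cov-∪ c c′)))

    -- The corner `p` sees two face neighbours, at most two vertices under one side, and at most `a`
    -- or `b` under a conditional other side. This is exactly the degree bound that the condition
    -- asks for.
    settle : ∀ {q p s} → Inner q p s → Kind q p → Kind p s → Good d ⊎ Plain q p × Plain p s
    settle I κ (cond _ _ _ _ ca _ ga _) = inj₁ (ga (cov-nbrs I (cov-right κ) ca))
    settle I (cond _ b _ _ _ cb _ gb) κ@(plain _) =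
      inj₁ (gb (cov-≤ (+-monoʳ-≤ 2 (≤-reflexive (+-comm b 2))) (cov-nbrs I cb (cov-left κ))))
    settle I (plain κ) (plain κ′) = inj₂ (κ , κ′)

    nbrs-plain : ∀ {q p s z} → Inner q p s → Empty p s → E p z → z ≡ s ⊎ z ≡ q ⊎ In p q p z
    nbrs-plain I empty pz with nbrs I pz
    ... | inj₁ eq = inj₂ (inj₁ eq)
    ... | inj₂ (inj₁ eq) = inj₁ eq
    ... | inj₂ (inj₂ (inj₁ i)) = inj₂ (inj₂ i)
    ... | inj₂ (inj₂ (inj₂ (e , p<z , z<s))) = ⊥-elim (empty (E⇒Vʳ e) p<z z<s)

    nbrs-plain′ : ∀ {q p s z} → Inner q p s → Empty q p → E p z → z ≡ q ⊎ z ≡ s ⊎ In p p s z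
    nbrs-plain′ I empty pz with nbrs I pz
    ... | inj₁ eq = inj₁ eq
    ... | inj₂ (inj₁ eq) = inj₂ (inj₁ eq)
    ... | inj₂ (inj₂ (inj₂ i)) = inj₂ (inj₂ i)
    ... | inj₂ (inj₂ (inj₁ (e , q<z , z<p))) = ⊥-elim (empty (E⇒Vʳ e) q<z z<p)

    lonely : ∀ {q p s} → Empty q p → Empty p s → ∀ {z} → V z → q < z → z < s → z ≡ p
    lonely {p = p} empty empty′ {z} vz q<z z<s with <-cmp z p
    ... | tri< z<p _ _ = ⊥-elim (empty vz q<z z<p)
    ... | tri≈ _ eq _ = eq
    ... | tri> _ _ p<z = ⊥-elim (empty′ vz p<z z<s)

    -- Unlike in `triangle-ear`, no edge from `q` to `s` is assumed, which is why `good-path` exists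
    -- beside `good-triangle`.
    path-ear : ∀ {q p s} → Inner q p s → Empty q p → Empty p s → Ear q p s
    path-ear I empty empty′ = ear q<p p<s qp ps (lonely empty empty′) nb
      where
      open Inner I
      nb : ∀ {z} → E _ z → z ≡ _ ⊎ z ≡ _
      nb pz with nbrs-plain I empty′ pz
      ... | inj₁ eq = inj₂ eq
      ... | inj₂ (inj₁ eq) = inj₁ eq
      ... | inj₂ (inj₂ (e , q<z , z<p)) = ⊥-elim (empty (E⇒Vʳ e) q<z z<p)

    cov-first : ∀ {p m} → Next x p → Cov (In x x p) m → Cov (In x x y) (1 + m)
    cov-first {p} (next _ _ _ top) cov = cov-⊆ split (cov-∪ (cov-≡ p) cov)
      where
      split : ∀ {z} → In x x y z → z ≡ p ⊎ In x x p z
      split {z} (xz , x<z , z<y) with <-cmp z p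
      ... | tri< z<p _ _ = inj₂ (xz , x<z , z<p)
      ... | tri≈ _ eq _ = inj₁ eq
      ... | tri> _ _ p<z = contradiction (proj₂ (top xz p<z (<⇒≤ z<y))) (<⇒≢ z<y)

    cov-last : ∀ {p m} → Sep p → p < y → Cov (In y p y) m → Cov (In y x y) (1 + m)
    cov-last {p} sep p<y cov = cov-⊆ split (cov-∪ (cov-≡ p) cov)
      where
      split : ∀ {z} → In y x y z → z ≡ p ⊎ In y p y z
      split {z} (yz , x<z , z<y) with <-cmp z p
      ... | tri< z<p _ _ = contradiction (sym (proj₁ (sep (E-sym yz) (<⇒≤ x<z) z<p p<y ≤-refl))) (<⇒≢ x<z)
      ... | tri≈ _ eq _ = inj₁ eq
      ... | tri> _ _ p<z = inj₂ (yz , p<z , z<y)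

    -- With one triangular side, `p` sees only its tip and the adjacent pair `x`, `y`, so the
    -- neighbours of one end cover everything and `d` suffices. With two, the other tip is left
    -- over, and degree at most 6 at the chosen end gives 4 + 1 ≤ `d`.
    three-sides : ∀ {p} → Inner x p y → Plain x p → Plain p y → Good d ⊎ Kind x y
    three-sides {p} I (edge empty) (edge empty′) =
      inj₂ (plain (tri p (E⇒V ps) q<p p<y (lonely empty empty′)))
      where open Inner I
    three-sides {p} I (edge empty) (tri u vu p<u u<y only) =
      inj₁ (good-triangle (inj₂ (triangle-ear ps vu p<u u<y only)) (E-sym ps) (degree y) split
        (cov-∅ {λ _ → ⊥} λ ()) (≤-reflexive (+-identityʳ d)))
      where
      open Inner I
      split : ∀ {z} → E p z → z ≡ y ⊎ z ≡ u ⊎ E y z ⊎ ⊥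
      split pz with nbrs-plain′ I empty pz
      ... | inj₁ refl = inj₂ (inj₂ (inj₁ (E-sym xy)))
      ... | inj₂ (inj₁ eq) = inj₁ eq
      ... | inj₂ (inj₂ (e , p<z , z<y)) = inj₂ (inj₁ (only (E⇒Vʳ e) p<z z<y))
    three-sides {p} I (tri u vu x<u u<p only) (edge empty) =
      inj₁ (good-triangle (inj₁ (triangle-ear qp vu x<u u<p only)) qp (degree x) split
        (cov-∅ {λ _ → ⊥} λ ()) (≤-reflexive (+-identityʳ d)))
      where
      open Inner I
      split : ∀ {z} → E p z → z ≡ x ⊎ z ≡ u ⊎ E x z ⊎ ⊥
      split pz with nbrs-plain I empty pz
      ... | inj₁ refl = inj₂ (inj₂ (inj₁ xy))
      ... | inj₂ (inj₁ eq) = inj₁ eq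
      ... | inj₂ (inj₂ (e , x<z , z<p)) = inj₂ (inj₁ (only (E⇒Vʳ e) x<z z<p))
    three-sides {p} I κ@(tri u vu x<u u<p only) κ′@(tri u′ vu′ p<u′ u′<y only′) =
      inj₂ (cond 2 2 ≤-refl ≤-refl (cov-first qp! (cov-plain κ))
        (cov-last (sep-next sep qp!) p<y (cov-plain κ′))
        (λ c → good-triangle (inj₁ (triangle-ear qp vu x<u u<p only)) qp c split (cov-≡ u′) 5≤d)
        (λ c → good-triangle (inj₂ (triangle-ear ps vu′ p<u′ u′<y only′)) (E-sym ps) c split′ (cov-≡ u) 5≤d))
      where
      open Inner I
      split : ∀ {z} → E p z → z ≡ x ⊎ z ≡ u ⊎ E x z ⊎ z ≡ u′
      split pz with nbrs I pz
      ... | inj₁ eq = inj₁ eq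
      ... | inj₂ (inj₁ refl) = inj₂ (inj₂ (inj₁ xy))
      ... | inj₂ (inj₂ (inj₁ (e , x<z , z<p))) = inj₂ (inj₁ (only (E⇒Vʳ e) x<z z<p))
      ... | inj₂ (inj₂ (inj₂ (e , p<z , z<y))) = inj₂ (inj₂ (inj₂ (only′ (E⇒Vʳ e) p<z z<y)))
      split′ : ∀ {z} → E p z → z ≡ y ⊎ z ≡ u′ ⊎ E y z ⊎ z ≡ u
      split′ pz with nbrs I pz
      ... | inj₁ refl = inj₂ (inj₂ (inj₁ (E-sym xy)))
      ... | inj₂ (inj₁ eq) = inj₁ eq
      ... | inj₂ (inj₂ (inj₁ (e , x<z , z<p))) = inj₂ (inj₂ (inj₂ (only (E⇒Vʳ e) x<z z<p)))
      ... | inj₂ (inj₂ (inj₂ (e , p<z , z<y))) = inj₂ (inj₁ (only′ (E⇒Vʳ e) p<z z<y))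

    -- At `x` the ear is the tip under `xp`, with only `r` left over, or, if that side is empty, `p`
    -- itself. In the latter case the edge `xy` accounts for `y`, and at most one vertex under `ry`
    -- is left over. Either count is 4 + 1; the end `y` is the mirror image.
    four-sides : ∀ {p r} → Inner x p r → Inner p r y → Plain x p → Empty p r → Plain r y → Kind x y
    four-sides {p} {r} I J κ empty κ′ =
      cond (1 + size κ) (1 + size κ′) (s≤s (size≤1 κ)) (s≤s (size≤1 κ′))
        (cov-first I.qp! (cov-plain κ)) (cov-last (sep-next J.sep J.qp!) J.p<y (cov-plain κ′))
        (goodˡ κ) (goodʳ κ′)
      where
      module I = Inner I
      module J = Inner J
      goodˡ : (κ : Plain x p) → Cov (E x) (5 + size κ) → Good d
      goodˡ (edge empty′) c = good-path (inj₁ (path-ear I empty′ empty)) c split (cov-plain κ′)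
                                (≤-trans (+-monoʳ-≤ 4 (size≤1 κ′)) 5≤d)
        where
        split : ∀ {z} → E r z → z ≡ p ⊎ E x z ⊎ In r r y z
        split rz with nbrs-plain′ J empty rz
        ... | inj₁ eq = inj₁ eq
        ... | inj₂ (inj₁ refl) = inj₂ (inj₁ xy)
        ... | inj₂ (inj₂ i) = inj₂ (inj₂ i)
      goodˡ (tri u vu x<u u<p only) c =
        good-triangle (inj₁ (triangle-ear I.qp vu x<u u<p only)) I.qp c split (cov-≡ r) 5≤d
        where
        split : ∀ {z} → E p z → z ≡ x ⊎ z ≡ u ⊎ E x z ⊎ z ≡ r
        split pz with nbrs-plain I empty pz
        ... | inj₁ eq = inj₂ (inj₂ (inj₂ eq))
        ... | inj₂ (inj₁ eq) = inj₁ eq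
        ... | inj₂ (inj₂ (e , x<z , z<p)) = inj₂ (inj₁ (only (E⇒Vʳ e) x<z z<p))
      goodʳ : (κ′ : Plain r y) → Cov (E y) (5 + size κ′) → Good d
      goodʳ (edge empty′) c = good-path (inj₂ (path-ear J empty empty′)) c split (cov-plain κ)
                                (≤-trans (+-monoʳ-≤ 4 (size≤1 κ)) 5≤d)
        where
        split : ∀ {z} → E p z → z ≡ r ⊎ E y z ⊎ In p x p z
        split pz with nbrs-plain I empty pz
        ... | inj₁ eq = inj₁ eq
        ... | inj₂ (inj₁ refl) = inj₂ (inj₁ (E-sym xy))
        ... | inj₂ (inj₂ i) = inj₂ (inj₂ i)
      goodʳ (tri u vu r<u u<y only) c =
        good-triangle (inj₂ (triangle-ear J.ps vu r<u u<y only)) (E-sym J.ps) c split (cov-≡ p) 5≤d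
        where
        split : ∀ {z} → E r z → z ≡ y ⊎ z ≡ u ⊎ E y z ⊎ z ≡ p
        split rz with nbrs-plain′ J empty rz
        ... | inj₁ eq = inj₂ (inj₂ (inj₂ eq))
        ... | inj₂ (inj₁ eq) = inj₁ eq
        ... | inj₂ (inj₂ (e , r<z , z<y)) = inj₂ (inj₁ (only (E⇒Vʳ e) r<z z<y))

    -- The interior corner `r` has at most five neighbours, two of them `u` and `p`; `p` adds `q`
    -- and at most one vertex under `qp`, so 3 + 2 ≤ `d`.
    inner-triangle : ∀ {q p r s} → Inner q p r → Inner p r s → Plain q p → Kind r s →
      ∀ u → V u → p < u → u < r → (∀ {z} → V z → p < z → z < r → z ≡ u) → Good d
    inner-triangle {q} {p} {r} I J κ κ′ u vu p<u u<r only =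
      good-triangle (inj₂ (triangle-ear I.ps vu p<u u<r only)) (E-sym I.ps)
        (cov-nbrs J (cov-plain (tri u vu p<u u<r only)) (cov-left κ′)) split
        (cov-∪ (cov-≡ q) (cov-plain κ)) (≤-trans (+-monoʳ-≤ 4 (size≤1 κ)) 5≤d)
      where
      module I = Inner I
      split : ∀ {z} → E p z → z ≡ r ⊎ z ≡ u ⊎ E r z ⊎ (z ≡ q ⊎ In p q p z)
      split pz with nbrs I pz
      ... | inj₁ eq = inj₂ (inj₂ (inj₂ (inj₁ eq)))
      ... | inj₂ (inj₁ eq) = inj₁ eq
      ... | inj₂ (inj₂ (inj₁ i)) = inj₂ (inj₂ (inj₂ (inj₂ i)))
      ... | inj₂ (inj₂ (inj₂ (e , p<z , z<r))) = inj₂ (inj₁ (only (E⇒Vʳ e) p<z z<r))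

    -- The ear is `r`. Its neighbour `s` has at most four neighbours, one of them `r`; `p` adds `x`
    -- and at most one vertex under `xp`, again 3 + 2 ≤ `d`.
    inner-path : ∀ {p r s t} → Inner x p r → Inner p r s → Inner r s t →
      Plain x p → Empty p r → Empty r s → Kind s t → Good d
    inner-path {p} {r} I J K κ empty empty′ κ′ =
      good-path (inj₂ (path-ear J empty empty′)) (cov-nbrs K (cov-plain (edge empty′)) (cov-left κ′))
        split (cov-∪ (cov-≡ x) (cov-plain κ)) (≤-trans (+-monoʳ-≤ 4 (size≤1 κ)) 5≤d)
      where
      split : ∀ {z} → E p z → z ≡ r ⊎ E _ z ⊎ (z ≡ x ⊎ In p x p z)
      split pz with nbrs-plain I empty pz
      ... | inj₁ eq = inj₁ eq
      ... | inj₂ i = inj₂ (inj₂ i)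

    -- The successor of `q` in `V` is adjacent to it, so the searches in `first` and `follow` cannot
    -- come up empty.
    nearest : ∀ {q w} → V q → V w → q < w → ∃ λ z → E q z × q < z × z ≤ w
    nearest {q} {w} vq vw q<w with least (λ z → V? z ×-dec (q <? z)) (suc w)
    ... | inj₂ none = ⊥-elim (none ≤-refl (vw , q<w))
    ... | inj₁ (z , z<1+w , (vz , q<z) , min) =
          z , adjacent vq vz q<z (λ vt q<t t<z → <⇒≱ t<z (min (vt , q<t))) , q<z , ≤-pred z<1+w

    first : ∀ {w} → V w → x < w → w < y → ∃ λ p → Next x p × p < y
    first vw x<w w<y with greatest (λ z → E? x z ×-dec (x <? z)) y
    ... | inj₂ none = let (z , xz , x<z , z≤w) = nearest (E⇒V xy) vw x<w
                      in ⊥-elim (none (≤-<-trans z≤w w<y) (xz , x<z))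
    ... | inj₁ (p , p<y , (xp , x<p) , max) = p , next xp x<p (<⇒≤ p<y) top , p<y
      where
      top : ∀ {z} → E x z → p < z → z ≤ y → x ≡ x × z ≡ y
      top xz p<z z≤y with m≤n⇒m<n∨m≡n z≤y
      ... | inj₁ z<y = contradiction (max z<y (xz , <-trans x<p p<z)) (<⇒≱ p<z)
      ... | inj₂ eq = refl , eq

    follow : ∀ {q} → V q → q < y → ∃ λ p → Next q p
    follow {q} vq q<y with greatest (λ z → E? q z ×-dec (q <? z)) (suc y)
    ... | inj₂ none = let (z , qz , q<z , z≤y) = nearest vq (E⇒Vʳ xy) q<y
                      in ⊥-elim (none (s≤s z≤y) (qz , q<z))
    ... | inj₁ (p , p<1+y , (qp , q<p) , max) = p , next qp q<p (≤-pred p<1+y)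
          λ qz p<z z≤y → contradiction (max (s≤s z≤y) (qz , <-trans q<p p<z)) (<⇒≱ p<z)

    -- Walks at most the four sides `xp`, `pr`, `rs`, `st`, settling corners on the way. A triangle
    -- over a side with both ends interior, or two consecutive empty sides with three interior
    -- corners, gives `Good d`. What survives has at most four sides, the middle one of four being
    -- empty.
    face : (∀ {q p} → x ≤ q → p ≤ y → x < q ⊎ p < y → q < p → E q p → Good d ⊎ Kind q p) →
           Good d ⊎ Kind x y
    face rec with least (λ z → V? z ×-dec (x <? z)) y
    ... | inj₂ none = inj₂ (plain (edge λ vz x<z z<y → none z<y (vz , x<z)))
    ... | inj₁ (w , w<y , (vw , x<w) , _) with first vw x<w w<y
    ... | p , xp , p<y with follow (E⇒Vʳ (Next.qp xp)) p<y
    ... | r , pr with rec ≤-refl (<⇒≤ p<y) (inj₂ p<y) (Next.q<p xp) (Next.qp xp)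
                    | rec (<⇒≤ (Next.q<p xp)) (Next.p≤y pr) (inj₁ (Next.q<p xp)) (Next.q<p pr) (Next.qp pr)
    ... | inj₁ g | _ = inj₁ g
    ... | inj₂ _ | inj₁ g = inj₁ g
    ... | inj₂ κ₁ | inj₂ κ₂ with settle (inner ≤-refl p<y sep-x xp pr) κ₁ κ₂
    ... | inj₁ g = inj₁ g
    ... | inj₂ (π₁ , π₂) with m≤n⇒m<n∨m≡n (Next.p≤y pr)
    ... | inj₂ refl = three-sides (inner ≤-refl p<y sep-x xp pr) π₁ π₂
    ... | inj₁ r<y = beyond π₂
      where
      I = inner ≤-refl p<y sep-x xp pr
      x<p = Next.q<p xp
      s! = follow (E⇒Vʳ (Next.qp pr)) r<y
      s = proj₁ s!
      rs = proj₂ s!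
      J = inner (<⇒≤ x<p) r<y (sep-next sep-x xp) pr rs
      x<r = <-trans x<p (Next.q<p pr)
      x<s = <-trans x<r (Next.q<p rs)
      last : Empty p r → Plain r s → s < y ⊎ s ≡ y → Good d ⊎ Kind x y
      last empty π₃ (inj₂ s≡y) = inj₂
        (four-sides I (subst (Inner p r) s≡y J) π₁ empty (subst (Plain r) s≡y π₃))
      last empty π₃ (inj₁ s<y) with follow (E⇒Vʳ (Next.qp rs)) s<y
      -- `st` is classified to bound the neighbours of `s` under it.
      ... | t , st with rec (<⇒≤ x<s) (Next.p≤y st) (inj₁ x<s) (Next.q<p st) (Next.qp st)
      ... | inj₁ g = inj₁ g
      ... | inj₂ κ₄ = inj₁ (good π₃)
        where
        K = inner (<⇒≤ x<r) s<y (sep-next (Inner.sep J) pr) rs st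
        good : Plain r s → Good d
        good (edge empty′) = inner-path I J K π₁ empty empty′ κ₄
        good (tri u vu r<u u<s only) = inner-triangle J K (edge empty) κ₄ u vu r<u u<s only
      beyond : Plain p r → Good d ⊎ Kind x y
      beyond π₂ with rec (<⇒≤ x<r) (Next.p≤y rs) (inj₁ x<r) (Next.q<p rs) (Next.qp rs)
      ... | inj₁ g = inj₁ g
      ... | inj₂ κ₃ with π₂
      ... | tri u vu p<u u<r only = inj₁ (inner-triangle I J π₁ κ₃ u vu p<u u<r only)
      ... | edge empty with settle J (plain (edge empty)) κ₃
      ... | inj₁ g = inj₁ g
      ... | inj₂ (_ , π₃) = last empty π₃ (m≤n⇒m<n∨m≡n (Next.p≤y rs))

  -- `f` bounds the length of the chord; every side of the face gives up at least one end of `xy`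
  -- and is therefore shorter.
  classify : ∀ f {x y} → y ≤ f + x → x < y → E x y → Good d ⊎ Kind x y
  classify zero y≤x x<y _ = contradiction y≤x (<⇒≱ x<y)
  classify (suc f) {x} {y} bound x<y xy = Chord.face x<y xy λ x≤q p≤y strict q<p qp →
    classify f (shorter x≤q p≤y strict) q<p qp
    where
    shorter : ∀ {q p} → x ≤ q → p ≤ y → x < q ⊎ p < y → p ≤ f + q
    shorter x≤q p≤y (inj₁ x<q) =
      ≤-trans p≤y (≤-trans bound (≤-trans (≤-reflexive (sym (+-suc f x))) (+-monoʳ-≤ f x<q)))
    shorter x≤q p≤y (inj₂ p<y) = ≤-trans (≤-pred (≤-trans p<y bound)) (+-monoʳ-≤ f x≤q)

  -- No vertex lies beyond the edge from 0 to `N`. So a conditional outcome leaves 0 with degree at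
  -- most 1 + `a`, within the required 4 + `a`, and in a triangle `N` sees only 0 and the tip.
  good⊎edge : Good d ⊎ Empty 0 N
  good⊎edge with classify N {0} {N} (≤-reflexive (sym (+-identityʳ N))) 0<N base
    where
    0<N : 0 < N
    0<N = n≢0⇒n>0 λ { refl → E-irrefl base }
  ... | inj₁ g = inj₁ g
  ... | inj₂ (plain (edge empty)) = inj₂ empty
  ... | inj₂ (plain κ@(tri u vu 0<u u<N only)) =
        inj₁ (good-triangle (inj₁ (triangle-ear base vu 0<u u<N only)) base (degree 0) split
          (cov-∅ {λ _ → ⊥} λ ()) (≤-reflexive (+-identityʳ d)))
        where
        split : ∀ {z} → E N z → z ≡ 0 ⊎ z ≡ u ⊎ E 0 z ⊎ ⊥
        split {z} Nz with z ≟ 0 | m≤n⇒m<n∨m≡n (V⇒≤ (E⇒Vʳ Nz))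
        ... | yes eq | _ = inj₁ eq
        ... | no z≢0 | inj₁ z<N = inj₂ (inj₁ (only (E⇒Vʳ Nz) (n≢0⇒n>0 z≢0) z<N))
        ... | no _ | inj₂ refl = ⊥-elim (E-irrefl Nz)
  ... | inj₂ (cond a _ _ _ ca _ ga _) =
        inj₁ (ga (cov-≤ (+-monoˡ-≤ a (s≤s z≤n)) (cov-⊆ split (cov-∪ (cov-≡ N) ca))))
        where
        split : ∀ {z} → E 0 z → z ≡ N ⊎ In 0 0 N z
        split {z} 0z with z ≟ 0 | m≤n⇒m<n∨m≡n (V⇒≤ (E⇒Vʳ 0z))
        ... | yes refl | _ = ⊥-elim (E-irrefl 0z)
        ... | no z≢0 | inj₁ z<N = inj₂ (0z , n≢0⇒n>0 z≢0 , z<N)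
        ... | no _ | inj₂ eq = inj₁ eq

-- Deleting an ear

module Remove {N} (P : Polygon N) {v u w} (e : Polygon.Ear P v u w) where
  open Polygon P
  open Ear e

  V₋ : ℕ → Set
  V₋ z = V z × z ≢ u

  -- The added edge keeps consecutive vertices adjacent and forces different colours on `v` and `w`;
  -- as a union of relations it is harmless if they were adjacent already.
  E₋ : ℕ → ℕ → Set
  E₋ a b = (E a b × a ≢ u × b ≢ u) ⊎ (a ≡ v × b ≡ w) ⊎ (a ≡ w × b ≡ v)

  gap : ∀ {z} → V₋ z → v < z → z < w → ⊥
  gap (vz , z≢u) v<z z<w = z≢u (lonely vz v<z z<w)

  E₋⇒V₋ : ∀ {a b} → E₋ a b → V₋ a
  E₋⇒V₋ (inj₁ (ab , a≢u , _)) = E⇒V ab , a≢u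
  E₋⇒V₋ (inj₂ (inj₁ (refl , refl))) = E⇒V vu , <⇒≢ v<u
  E₋⇒V₋ (inj₂ (inj₂ (refl , refl))) = E⇒Vʳ uw , >⇒≢ u<w

  E₋-sym : ∀ {a b} → E₋ a b → E₋ b a
  E₋-sym (inj₁ (ab , a≢u , b≢u)) = inj₁ (E-sym ab , b≢u , a≢u)
  E₋-sym (inj₂ (inj₁ (p , q))) = inj₂ (inj₂ (q , p))
  E₋-sym (inj₂ (inj₂ (p , q))) = inj₂ (inj₁ (q , p))

  v<w : v < w
  v<w = <-trans v<u u<w

  -- An edge crossing `vw` would have an end strictly between `v` and `w`, where only `u` was.
  planar₋ : ∀ {a b c d} → E₋ a b → E₋ c d → a < c → c < b → b < d → ⊥
  planar₋ (inj₁ (ab , _)) (inj₁ (cd , _)) = planar ab cd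
  planar₋ (inj₂ (inj₁ (refl , refl))) cd a<c c<b b<d = gap (E₋⇒V₋ cd) a<c c<b
  planar₋ (inj₂ (inj₂ (refl , refl))) cd a<c c<b b<d = <-asym v<w (<-trans a<c c<b)
  planar₋ ab@(inj₁ _) (inj₂ (inj₁ (refl , refl))) a<c c<b b<d = gap (E₋⇒V₋ (E₋-sym ab)) c<b b<d
  planar₋ ab@(inj₁ _) (inj₂ (inj₂ (refl , refl))) a<c c<b b<d = <-asym v<w (<-trans c<b b<d)

  -- If `u` is not between `x` and `y`, they were consecutive before; otherwise they are its two
  -- neighbours.
  adjacent₋ : ∀ {x y} → V₋ x → V₋ y → x < y → (∀ {z} → V₋ z → x < z → z < y → ⊥) → E₋ x y
  adjacent₋ {x} {y} (vx , x≢u) (vy , y≢u) x<y none with x <? u | u <? y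
  ... | no x≮u | _ = inj₁ (adjacent vx vy x<y
          (λ vz x<z z<y → none (vz , λ { refl → x≮u x<z }) x<z z<y) , x≢u , y≢u)
  ... | _ | no u≮y = inj₁ (adjacent vx vy x<y
          (λ vz x<z z<y → none (vz , λ { refl → u≮y z<y }) x<z z<y) , x≢u , y≢u)
  ... | yes x<u | yes u<y = inj₂ (inj₁ (x≡v , y≡w))
    where
    x≡v : x ≡ v
    x≡v with <-cmp x v
    ... | tri< x<v _ _ = ⊥-elim (none (E⇒V vu , <⇒≢ v<u) x<v (<-trans v<u u<y))
    ... | tri≈ _ eq _ = eq
    ... | tri> _ _ v<x = ⊥-elim (gap (vx , x≢u) v<x (<-trans x<u u<w))
    y≡w : y ≡ w
    y≡w with <-cmp w y
    ... | tri< w<y _ _ = ⊥-elim (none (E⇒Vʳ uw , >⇒≢ u<w) (<-trans x<u u<w) w<y)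
    ... | tri≈ _ eq _ = sym eq
    ... | tri> _ _ y<w = ⊥-elim (gap (vy , y≢u) (<-trans v<u u<y) y<w)

  removed : Polygon N
  removed = record
    { V = V₋
    ; V? = λ z → V? z ×-dec ¬? (z ≟ u)
    ; E = E₋
    ; E? = λ a b → (E? a b ×-dec (¬? (a ≟ u) ×-dec ¬? (b ≟ u))) ⊎-dec
                   (((a ≟ v) ×-dec (b ≟ w)) ⊎-dec ((a ≟ w) ×-dec (b ≟ v)))
    ; E-sym = E₋-sym
    ; E-irrefl = λ { (inj₁ (aa , _)) → E-irrefl aa
                   ; (inj₂ (inj₁ (refl , eq))) → <⇒≢ v<w eq
                   ; (inj₂ (inj₂ (refl , eq))) → >⇒≢ v<w eq }
    ; E⇒V = E₋⇒V₋
    ; V⇒≤ = λ { (vz , _) → V⇒≤ vz }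
    ; base = inj₁ (base , <⇒≢ (≤-<-trans z≤n v<u) , >⇒≢ (<-≤-trans u<w (V⇒≤ (E⇒Vʳ uw))))
    ; planar = planar₋
    ; adjacent = adjacent₋
    }

  -- Only `v` and `w` can gain a neighbour, and each loses `u` in exchange.
  degree₋ : ∀ {m} → (∀ z → Cov (E z) (suc m)) → ∀ z → Cov (E₋ z) (suc m)
  degree₋ degree z with z ≟ v | z ≟ w
  ... | yes refl | _ =
        cov-⊆ (λ { (inj₁ (e′ , _ , ne)) → inj₂ (e′ , ne)
                 ; (inj₂ (inj₁ (_ , eq))) → inj₁ eq
                 ; (inj₂ (inj₂ (eq , _))) → contradiction eq (<⇒≢ v<w) })
              (cov-∪ (cov-≡ w) (cov-∖ vu (degree v)))
  ... | no _ | yes refl =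
        cov-⊆ (λ { (inj₁ (e′ , _ , ne)) → inj₂ (e′ , ne)
                 ; (inj₂ (inj₁ (eq , _))) → contradiction eq (>⇒≢ v<w)
                 ; (inj₂ (inj₂ (_ , eq))) → inj₁ eq })
              (cov-∪ (cov-≡ v) (cov-∖ (E-sym uw) (degree w)))
  ... | no z≢v | no z≢w = cov-⊆ (λ { (inj₁ (e′ , _)) → e′
                                   ; (inj₂ (inj₁ (eq , _))) → contradiction eq z≢v
                                   ; (inj₂ (inj₂ (eq , _))) → contradiction eq z≢w }) (degree z)

-- Counting colours by their classes

unique-length : ∀ {m} l → Unique l → Cov (_∈ l) m → length l ≤ m
unique-length [] _ _ = z≤n
unique-length {zero} (x ∷ l) _ ([] , _ , cov) with () ← cov (here refl)
unique-length {suc m} (x ∷ l) (x∉l ∷ uniq) cov =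
  s≤s (unique-length l uniq
    (cov-⊆ (λ z∈l → there z∈l , ≢-sym (All.lookup x∉l z∈l)) (cov-∖ (here refl) cov)))

cov-same : ∀ l → (∀ {t z} → t ∈ l → z ∈ l → z ≡ t) → Cov (_∈ l) 1
cov-same [] _ = [] , z≤n , λ ()
cov-same (t ∷ _) same = cov-⊆ (same (here refl)) (cov-≡ t)

module _ (c : ℕ → ℤ) where

  class : ℤ → List ℕ → List ℕ
  class a = filter (λ z → c z ℤ.≟ a)

  others : ℤ → List ℕ → List ℕ
  others a = filter (λ z → ¬? (c z ℤ.≟ a))

  class-others : ∀ {a b} → a ≢ b → ∀ l → class b (others a l) ≡ class b l
  class-others a≢b [] = refl
  class-others {a} {b} a≢b (z ∷ l) with c z ℤ.≟ a
  ... | yes refl with c z ℤ.≟ b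
  ...   | yes refl = contradiction refl a≢b
  ...   | no _ = class-others a≢b l
  class-others {a} {b} a≢b (z ∷ l) | no _ with c z ℤ.≟ b
  ...   | yes _ = cong (z ∷_) (class-others a≢b l)
  ...   | no _ = class-others a≢b l

  length-split : ∀ a l → length (class a l) + length (others a l) ≡ length l
  length-split a [] = refl
  length-split a (z ∷ l) with c z ℤ.≟ a
  ... | yes _ = cong suc (length-split a l)
  ... | no _ = trans (+-suc _ _) (cong suc (length-split a l))

  -- Distinct colours have disjoint classes: peeling off the class of `a` leaves those of the
  -- remaining colours intact.
  large-classes : ∀ {k} as l → Unique as → All (λ a → k ≤ length (class a l)) as →
                  length as * k ≤ length l
  large-classes [] l _ _ = z≤n
  large-classes {k} (a ∷ as) l (a∉as ∷ uniq) (k≤ ∷ large) = ≤-trans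
    (+-mono-≤ k≤ (large-classes as (others a l) uniq
      (All.zipWith (λ { (a≢b , k≤b) → subst (λ l′ → k ≤ length l′) (sym (class-others a≢b l)) k≤b })
                   (a∉as , large))))
    (≤-reflexive (length-split a l))

without : ℤ → List ℤ → List ℤ
without α = filter (λ a → ¬? (a ℤ.≟ α))

length-without : ∀ α as → Unique as → length as ≤ suc (length (without α as))
length-without α [] _ = z≤n
length-without α (a ∷ as) (a∉as ∷ uniq) with a ℤ.≟ α
... | yes refl = s≤s (≤-reflexive (cong length (sym (filter-all _ (All.map ≢-sym a∉as)))))
... | no _ = s≤s (length-without α as uniq)

-- Colouring a polygon from lists

module Colour (k d : ℕ) .{{_ : NonZero k}} (5≤d : 5 ≤ d) {N : ℕ} (L : ℕ → List ℤ)
              (listed : ∀ z → Unique (L z) × length (L z) ≡ d / k + 3) where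

  -- Excluding `α` and `β` leaves at least `d / k + 1` colours of the list. If each occurred `k`
  -- times in `l`, then `l` would be longer than `d`.
  free-colour : ∀ c l → length l ≤ d → ∀ z α β →
                ∃ λ a → a ∈ L z × a ≢ α × a ≢ β × length (class c a l) < k
  free-colour c l len z α β with any? (λ a → length (class c a l) <? k) (without β (without α (L z)))
  ... | yes found = let (a , a∈ , small) = find found
                        (a∈′ , a≢β) = ∈-filter⁻ _ {xs = without α (L z)} a∈
                        (a∈L , a≢α) = ∈-filter⁻ _ {xs = L z} a∈′
                    in a , a∈L , a≢α , a≢β , small
  ... | no none = contradiction too-many (<⇒≱ ≤-refl)
    where
    uniq = Unique.filter⁺ (λ a → ¬? (a ℤ.≟ α)) (proj₁ (listed z))
    uniq′ = Unique.filter⁺ (λ a → ¬? (a ℤ.≟ β)) uniq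
    as = without β (without α (L z))
    long : suc (d / k) ≤ length as
    long = ≤-pred (≤-pred (begin
      3 + d / k                            ≡⟨ +-comm 3 (d / k) ⟩
      d / k + 3                            ≡⟨ proj₂ (listed z) ⟨
      length (L z)                         ≤⟨ length-without α (L z) (proj₁ (listed z)) ⟩
      suc (length (without α (L z)))       ≤⟨ s≤s (length-without β _ uniq) ⟩
      2 + length as                        ∎))
      where open ≤-Reasoning
    too-many : suc (d / k) ≤ d / k
    too-many = begin
      suc (d / k)              ≡⟨ m*n/n≡m (suc (d / k)) k ⟨
      (suc (d / k) * k) / k    ≤⟨ /-monoˡ-≤ k (begin
        suc (d / k) * k          ≤⟨ *-monoˡ-≤ k long ⟩
        length as * k            ≤⟨ large-classes c as l uniq′ (All.map ≮⇒≥ (¬Any⇒All¬ as none)) ⟩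
        length l                 ≤⟨ len ⟩
        d                        ∎) ⟩
      d / k                    ∎
      where open ≤-Reasoning

  record Colouring (P : Polygon N) : Set where
    open Polygon P
    field
      c      : ℕ → ℤ
      list   : ∀ {z} → V z → c z ∈ L z
      proper : ∀ {y z} → E y z → c y ≢ c z
      -- Duplicate-free lists stand for sets of neighbours, so no count over the predicate `E y` is
      -- ever formed.
      frugal : ∀ y a l → Unique l → (∀ {z} → z ∈ l → E y z × c z ≡ a) → length l ≤ k

  1≤k : 1 ≤ k
  1≤k = >-nonZero⁻¹ k

  extend : (P : Polygon N) → ∀ {v u w} (e : Polygon.Ear P v u w) → Cov (Polygon.Far P v u w) d →
           Colouring (Remove.removed P e) → Colouring P
  extend P {v} {u} {w} e (far , far≤d , far-cov) C
    with α , α∈L , α≢v , α≢w , small ←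
           free-colour (Colouring.c C) far far≤d u (Colouring.c C v) (Colouring.c C w)
    = record { c = c′ ; list = list′ ; proper = proper′ ; frugal = frugal′ }
    where
    open Polygon P
    open Ear e
    open Remove P e
    open Colouring C

    c′ : ℕ → ℤ
    c′ z with z ≟ u
    ... | yes _ = α
    ... | no _ = c z

    c′-u : c′ u ≡ α
    c′-u with u ≟ u
    ... | yes _ = refl
    ... | no u≢u = contradiction refl u≢u

    c′-≢ : ∀ {z} → z ≢ u → c′ z ≡ c z
    c′-≢ {z} z≢u with z ≟ u
    ... | yes eq = contradiction eq z≢u
    ... | no _ = refl

    list′ : ∀ {z} → V z → c′ z ∈ L z
    list′ {z} vz with z ≟ u
    ... | yes refl = α∈L
    ... | no z≢u = list (vz , z≢u)

    proper-u : ∀ {z} → E u z → c′ u ≢ c′ z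
    proper-u uz eq with nbrs uz
    ... | inj₁ refl = α≢v (trans (sym c′-u) (trans eq (c′-≢ (<⇒≢ v<u))))
    ... | inj₂ refl = α≢w (trans (sym c′-u) (trans eq (c′-≢ (>⇒≢ u<w))))

    proper′ : ∀ {y z} → E y z → c′ y ≢ c′ z
    proper′ {y} {z} yz = by-cases (y ≟ u) (z ≟ u)
      where
      by-cases : Dec (y ≡ u) → Dec (z ≡ u) → c′ y ≢ c′ z
      by-cases (yes refl) _ = proper-u yz
      by-cases _ (yes refl) eq = proper-u (E-sym yz) (sym eq)
      by-cases (no y≢u) (no z≢u) eq =
        proper (inj₁ (yz , y≢u , z≢u)) (trans (sym (c′-≢ y≢u)) (trans eq (c′-≢ z≢u)))

    module _ (y : ℕ) (a : ℤ) (l : List ℕ) (uniq : Unique l)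
             (mono : ∀ {z} → z ∈ l → E y z × c′ z ≡ a) where

      old : y ≢ u → (∀ {z} → z ∈ l → z ≢ u) → length l ≤ k
      old y≢u ne = frugal y a l uniq λ z∈l →
        inj₁ (proj₁ (mono z∈l) , y≢u , ne z∈l) , trans (sym (c′-≢ (ne z∈l))) (proj₂ (mono z∈l))

      -- The edge added between `v` and `w` gave them different colours, so at most one of them is
      -- in `l`.
      at-u : y ≡ u → length l ≤ k
      at-u refl = ≤-trans (unique-length l uniq (cov-same l only)) 1≤k
        where
        v≁w : v ∈ l → w ∈ l → ⊥
        v≁w v∈l w∈l = proper (inj₂ (inj₁ (refl , refl)))
          (trans (sym (c′-≢ (<⇒≢ v<u)))
            (trans (trans (proj₂ (mono v∈l)) (sym (proj₂ (mono w∈l)))) (c′-≢ (>⇒≢ u<w))))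
        only : ∀ {t z} → t ∈ l → z ∈ l → z ≡ t
        only t∈l z∈l with nbrs (proj₁ (mono t∈l)) | nbrs (proj₁ (mono z∈l))
        ... | inj₁ refl | inj₁ refl = refl
        ... | inj₁ refl | inj₂ refl = ⊥-elim (v≁w t∈l z∈l)
        ... | inj₂ refl | inj₁ refl = ⊥-elim (v≁w z∈l t∈l)
        ... | inj₂ refl | inj₂ refl = refl

      -- Neither `v` nor `w` has colour `α`, so besides `u` only far vertices in `l` can, and fewer
      -- than `k` of those do.
      beside-u : y ≡ v ⊎ y ≡ w → a ≡ α → length l ≤ k
      beside-u y∈ refl = ≤-trans (unique-length l uniq
        (cov-⊆ split (cov-∪ (cov-≡ u) (class c α far , ≤-refl , id)))) small
        where
        edge-of : ∀ {z} → y ≡ v ⊎ y ≡ w → E y z → E v z ⊎ E w z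
        edge-of (inj₁ refl) = inj₁
        edge-of (inj₂ refl) = inj₂
        split : ∀ {z} → z ∈ l → z ≡ u ⊎ z ∈ class c α far
        split {z} z∈l with z ≟ u
        ... | yes eq = inj₁ eq
        ... | no z≢u = inj₂ (∈-filter⁺ _ (far-cov (edge-of y∈ (proj₁ (mono z∈l)) , z≢u ,
                          (λ { refl → α≢v (sym cz) }) , (λ { refl → α≢w (sym cz) }))) cz)
          where
          cz : c z ≡ α
          cz = trans (sym (c′-≢ z≢u)) (proj₂ (mono z∈l))

      frugal′ : length l ≤ k
      frugal′ with y ≟ u | a ℤ.≟ α | (y ≟ v) ⊎-dec (y ≟ w)
      ... | yes y≡u | _ | _ = at-u y≡u
      ... | no y≢u | yes a≡α | yes y∈ = beside-u y∈ a≡α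
      -- In the remaining cases `u` is not in `l`: its colour is not `a`, or `y` is not its
      -- neighbour.
      ... | no y≢u | no a≢α | _ = old y≢u λ { z∈l refl → a≢α (trans (sym (proj₂ (mono z∈l))) c′-u) }
      ... | no y≢u | _ | no y∉ = old y≢u λ { z∈l refl → y∉ (nbrs (E-sym (proj₁ (mono z∈l)))) }

  two-vertices : (P : Polygon N) → Polygon.Empty P 0 N → Colouring P
  two-vertices P empty
    -- With an empty list no colour is saturated. The excluded `ℤ.0ℤ` is a dummy; the second call
    -- excludes `α`.
    with α , α∈L , _ ← free-colour (λ _ → ℤ.0ℤ) [] z≤n 0 ℤ.0ℤ ℤ.0ℤ
    with β , β∈L , β≢α , _ ← free-colour (λ _ → ℤ.0ℤ) [] z≤n N α α
    = record { c = c ; list = list ; proper = proper ; frugal = frugal }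
    where
    open Polygon P

    c : ℕ → ℤ
    c zero = α
    c (suc _) = β

    0∨N : ∀ {z} → V z → z ≡ 0 ⊎ z ≡ N
    0∨N {z} vz with z ≟ 0 | m≤n⇒m<n∨m≡n (V⇒≤ vz)
    ... | yes eq | _ = inj₁ eq
    ... | no z≢0 | inj₁ z<N = ⊥-elim (empty vz (n≢0⇒n>0 z≢0) z<N)
    ... | no _ | inj₂ eq = inj₂ eq

    list : ∀ {z} → V z → c z ∈ L z
    list {zero} _ = α∈L
    list {suc z} vz with inj₂ refl ← 0∨N vz = β∈L

    proper : ∀ {y z} → E y z → c y ≢ c z
    proper {zero} {zero} yz = ⊥-elim (E-irrefl yz)
    proper {zero} {suc z} _ α≡β = β≢α (sym α≡β)
    proper {suc y} {zero} _ = β≢α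
    proper {suc y} {suc z} yz
      with inj₂ refl ← 0∨N (E⇒V yz) | inj₂ refl ← 0∨N (E⇒Vʳ yz) = ⊥-elim (E-irrefl yz)

    frugal : ∀ y a l → Unique l → (∀ {z} → z ∈ l → E y z × c z ≡ a) → length l ≤ k
    frugal zero a l uniq nb = ≤-trans (unique-length l uniq (cov-⊆ at-N (cov-≡ N))) 1≤k
      where
      at-N : ∀ {z} → z ∈ l → z ≡ N
      at-N z∈l with 0∨N (E⇒Vʳ (proj₁ (nb z∈l)))
      ... | inj₁ refl = ⊥-elim (E-irrefl (proj₁ (nb z∈l)))
      ... | inj₂ eq = eq
    frugal (suc y) a l uniq nb = ≤-trans (unique-length l uniq (cov-⊆ at-0 (cov-≡ 0))) 1≤k
      where
      at-0 : ∀ {z} → z ∈ l → z ≡ 0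
      at-0 z∈l with 0∨N (E⇒V (proj₁ (nb z∈l))) | 0∨N (E⇒Vʳ (proj₁ (nb z∈l)))
      ... | _ | inj₁ eq = eq
      ... | inj₂ refl | inj₂ refl = ⊥-elim (E-irrefl (proj₁ (nb z∈l)))

  -- Induction on a bound `m` for the number of vertices; the degree bound survives each removal by
  -- `degree₋`.
  colour : ∀ m (P : Polygon N) → Cov (Polygon.V P) m → (∀ z → Cov (Polygon.E P z) (2 + d)) → Colouring P
  colour m P verts degree with Structure.good⊎edge P d 5≤d degree
  ... | inj₂ empty = two-vertices P empty
  colour zero P ([] , _ , cov) degree | inj₁ (_ , _ , _ , e , _)
    with () ← cov (Polygon.E⇒V P (Polygon.Ear.uw e))
  colour (suc m) P verts degree | inj₁ (v , u , w , e , far) =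
    extend P e far (colour m (Remove.removed P e)
      (cov-∖ (Polygon.E⇒V P (Polygon.Ear.uw e)) verts) (Remove.degree₋ P e degree))

-- Finite sums, surjectivity and reachability

∑-indicator : ∀ {A : Set} (b : A → Bool) l →
  foldr _+_ 0 (map (λ u → if b u then 1 else 0) l) ≡ length (filter (λ u → b u Bool.≟ true) l)
∑-indicator b [] = refl
∑-indicator b (u ∷ l) with b u
... | true = cong suc (∑-indicator b l)
... | false = ∑-indicator b l

≤-max : ∀ {A : Set} (f : A → ℕ) {u l} → u ∈ l → f u ≤ foldr _⊔_ 0 (map f l)
≤-max f {l = _ ∷ l} (here refl) = m≤m⊔n _ _
≤-max f {l = t ∷ l} (there u∈l) = ≤-trans (≤-max f u∈l) (m≤n⊔m (f t) _)

injective⇒hit : ∀ {N} (f : Fin (suc N) → Fin (suc N)) → (∀ u v → f u ≡ f v → u ≡ v) →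
  ∀ x → ∃ λ u → f u ≡ x
injective⇒hit {N} f inj x with Fin.any? (λ u → f u Fin.≟ x)
... | yes hit = hit
... | no miss = ⊥-elim (1+n≰n (Fin.injective⇒≤ {f = λ u → punchOut (x≢f u)}
        λ {u} {v} eq → inj u v (Fin.punchOut-injective (x≢f u) (x≢f v) eq)))
  where
  x≢f : ∀ u → x ≢ f u
  x≢f u eq = miss (u , sym eq)

reach-closed : ∀ {n} {G : Graph n} {R S : Fin n → Set} → (∀ {a b} → S a → Adj G a b → ¬ R b → S b) →
  ∀ {a b} → Reach G R a b → S a → S b
reach-closed closed here sa = sa
reach-closed closed (step ab ¬rb r) sa = reach-closed closed r (closed sa ab ¬rb)

-- From circular drawings to polygons

module Circle {N} (G : Graph (suc N)) (two : TwoConnected G) (outer : Outerplanar G) where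

  pos = proj₁ outer

  at : Fin (suc N) → ℕ
  at u = toℕ (pos u)

  at-injective : ∀ {u v} → at u ≡ at v → u ≡ v
  at-injective {u} {v} eq = proj₁ (proj₂ outer) u v (Fin.toℕ-injective eq)

  V : ℕ → Set
  V z = ∃ λ u → at u ≡ z

  E : ℕ → ℕ → Set
  E a b = ∃ λ u → ∃ λ v → at u ≡ a × at v ≡ b × Adj G u v

  V? : ∀ z → Dec (V z)
  V? z = Fin.any? λ u → at u ≟ z

  E? : ∀ a b → Dec (E a b)
  E? a b = Fin.any? λ u → Fin.any? λ v → (at u ≟ a) ×-dec ((at v ≟ b) ×-dec (adj G u v Bool.≟ true))

  V⇒≤ : ∀ {z} → V z → z ≤ N
  V⇒≤ (u , refl) = ≤-pred (Fin.toℕ<n (pos u))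

  adj⇒E : ∀ {u v} → Adj G u v → E (at u) (at v)
  adj⇒E uv = _ , _ , refl , refl , uv

  adj-sym : ∀ {u v} → Adj G u v → Adj G v u
  adj-sym {u} {v} uv = trans (Graph.sym G v u) uv

  adj-irrefl : ∀ {u} → ¬ Adj G u u
  adj-irrefl {u} uu with () ← trans (sym uu) (irrefl G u)

  cross : ∀ {a b c d} → Adj G a b → Adj G c d → at a < at c → at c < at b → at b < at d → ⊥
  cross ab cd p q r = proj₂ (proj₂ outer) _ _ _ _ ab cd (p , q , r)

  neighbour : ∀ {u v} → u ≢ v → ∃ λ w → Adj G u w
  neighbour {u} {v} u≢v with proj₁ (proj₂ two) u v
  ... | here = contradiction refl u≢v
  ... | step uw _ _ = _ , uw

  -- y is a cut vertex as soon as some S ∌ y is closed under adjacency outside y.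
  no-cut : ∀ {u v y} (S : Fin (suc N) → Set) → S v → ¬ S u → v ≢ y → u ≢ y →
    (∀ {a b} → S a → Adj G a b → b ≢ y → S b) → ⊥
  no-cut {u} {v} {y} S sv ¬su v≢y u≢y closed =
    ¬su (reach-closed closed (proj₂ (proj₂ two) y v u v≢y u≢y) sv)

  at-≢ : ∀ {u v} → at u < at v → u ≢ v
  at-≢ lt refl = <-irrefl refl lt

  -- Let `y` be the first neighbour of `u` above it. If `uv` is no edge, `v` lies strictly between
  -- `u` and `y`. An edge leaving that stretch other than to `y` would cross `uy` or end in `u`
  -- against the choice of `y`, so `y` would be a cut vertex.
  adjacent : ∀ {u v} → at u < at v → (∀ w → at u < at w → at w < at v → ⊥) → Adj G u v
  adjacent {u} {v} u<v none with adj G u v Bool.≟ true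
  ... | yes uv = uv
  ... | no ¬uv with least (λ z → E? (at u) z ×-dec (at u <? z)) (suc N)
  ... | inj₁ (.(at y) , _ , ((_ , y , eq , refl , uy) , u<y) , min) with refl ← at-injective eq =
    ⊥-elim (no-cut (λ w → at u < at w × at w < at y) (u<v , v<y) (λ (u<u , _) → <-irrefl refl u<u)
      (at-≢ v<y) (at-≢ u<y) closed)
    where
    v<y : at v < at y
    v<y with <-cmp (at v) (at y)
    ... | tri< v<y _ _ = v<y
    ... | tri≈ _ eq _ = contradiction (subst (Adj G u) (sym (at-injective eq)) uy) ¬uv
    ... | tri> _ _ y<v = ⊥-elim (none y u<y y<v)
    closed : ∀ {a b} → at u < at a × at a < at y → Adj G a b → b ≢ y → at u < at b × at b < at y
    closed {a} {b} (u<a , a<y) ab b≢y with <-cmp (at u) (at b) | <-cmp (at b) (at y)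
    ... | tri< u<b _ _ | tri< b<y _ _ = u<b , b<y
    ... | _ | tri≈ _ eq _ = contradiction (at-injective eq) b≢y
    ... | _ | tri> _ _ y<b = ⊥-elim (cross uy ab u<a a<y y<b)
    ... | tri≈ _ eq _ | _ with refl ← at-injective eq =
          contradiction (min (adj⇒E (adj-sym ab) , u<a)) (<⇒≱ a<y)
    ... | tri> _ _ b<u | _ = ⊥-elim (cross (adj-sym ab) uy b<u u<a a<y)
  -- With all neighbours of `u` below it, take the lowest, `y`; what it cuts off are now the
  -- positions below `y` or above `u`, among them that of `v`.
  adjacent {u} {v} u<v none | no ¬uv | inj₂ noneAbove with least (E? (at u)) (suc N)
  ... | inj₂ isolated = let (w , uw) = neighbour (at-≢ u<v)
                      in ⊥-elim (isolated (Fin.toℕ<n (pos w)) (adj⇒E uw))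
  ... | inj₁ (.(at y) , _ , (_ , y , eq , refl , uy) , min) with refl ← at-injective eq =
    ⊥-elim (no-cut (λ w → at w < at y ⊎ at u < at w) (inj₂ u<v)
      [ <-asym y<u , <-irrefl refl ]′ (≢-sym (at-≢ (<-trans y<u u<v))) (≢-sym (at-≢ y<u)) closed)
    where
    y<u : at y < at u
    y<u with <-cmp (at y) (at u)
    ... | tri< y<u _ _ = y<u
    ... | tri≈ _ eq _ with refl ← at-injective eq = ⊥-elim (adj-irrefl uy)
    ... | tri> _ _ u<y = ⊥-elim (noneAbove (Fin.toℕ<n (pos y)) (adj⇒E uy , u<y))
    closed : ∀ {a b} → at a < at y ⊎ at u < at a → Adj G a b → b ≢ y → at b < at y ⊎ at u < at b
    closed {a} {b} sa ab b≢y with <-cmp (at b) (at y) | <-cmp (at b) (at u)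
    ... | tri< b<y _ _ | _ = inj₁ b<y
    ... | _ | tri> _ _ u<b = inj₂ u<b
    ... | tri≈ _ eq _ | _ = contradiction (at-injective eq) b≢y
    closed {a} {b} (inj₁ a<y) ab b≢y | tri> _ _ y<b | tri< b<u _ _ =
          ⊥-elim (cross ab (adj-sym uy) a<y y<b b<u)
    closed {a} {b} (inj₂ u<a) ab b≢y | tri> _ _ y<b | tri< b<u _ _ =
          ⊥-elim (cross (adj-sym uy) (adj-sym ab) y<b b<u u<a)
    closed {a} {b} sa ab b≢y | tri> _ _ y<b | tri≈ _ eq′ _ with refl ← at-injective eq′ with sa
    ... | inj₁ a<y = contradiction (min (adj⇒E (adj-sym ab))) (<⇒≱ a<y)
    ... | inj₂ u<a = ⊥-elim (noneAbove (Fin.toℕ<n (pos a)) (adj⇒E (adj-sym ab) , u<a))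

  -- The last neighbour `y` of `u`, if not `v`, would cut off all later positions: an edge from
  -- there to before `y` crosses `uy` or gives `u` a later neighbour.
  ends-adjacent : ∀ {u v} → at u ≡ 0 → at v ≡ N → Adj G u v
  ends-adjacent {u} {v} u≡0 v≡N with adj G u v Bool.≟ true
  ... | yes uv = uv
  ... | no ¬uv with greatest (E? (at u)) (suc N)
  ... | inj₂ isolated = let (w , uw) = neighbour (at-≢ {u} {v} u<v)
                      in ⊥-elim (isolated (Fin.toℕ<n (pos w)) (adj⇒E uw))
    where
    u<v : at u < at v
    u<v = subst₂ _<_ (sym u≡0) (sym v≡N) (≤-trans (s≤s z≤n) (≤-pred (proj₁ two)))
  ... | inj₁ (.(at y) , _ , (_ , y , eq , refl , uy) , max) with refl ← at-injective eq =
    ⊥-elim (no-cut (λ w → at y < at w) y<v (<⇒≯ u<y) (≢-sym (at-≢ y<v)) (at-≢ u<y) closed)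
    where
    min : ∀ w → w ≢ u → at u < at w
    min w w≢u = ≤∧≢⇒< (subst (_≤ at w) (sym u≡0) z≤n) λ eq → w≢u (sym (at-injective eq))
    u<y : at u < at y
    u<y = min y λ { refl → adj-irrefl uy }
    y<v : at y < at v
    y<v = ≤∧≢⇒< (subst (at y ≤_) (sym v≡N) (V⇒≤ (y , refl)))
            λ eq → ¬uv (subst (Adj G u) (at-injective eq) uy)
    closed : ∀ {a b} → at y < at a → Adj G a b → b ≢ y → at y < at b
    closed {a} {b} y<a ab b≢y with <-cmp (at y) (at b) | b Fin.≟ u
    ... | tri< y<b _ _ | _ = y<b
    ... | tri≈ _ eq _ | _ = contradiction (sym (at-injective eq)) b≢y
    ... | tri> _ _ b<y | yes refl = contradiction (max (Fin.toℕ<n (pos a)) (adj⇒E (adj-sym ab))) (<⇒≱ y<a)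
    ... | tri> _ _ b<y | no b≢u = ⊥-elim (cross uy (adj-sym ab) (min b b≢u) b<y y<a)

  polygon : Polygon N
  polygon = record
    { V = V
    ; V? = V?
    ; E = E
    ; E? = E?
    ; E-sym = λ { (u , v , p , q , uv) → v , u , q , p , adj-sym uv }
    ; E-irrefl = λ { (u , v , refl , q , uv) → adj-irrefl (subst (Adj G u) (at-injective q) uv) }
    ; E⇒V = λ { (u , _ , p , _) → u , p }
    ; V⇒≤ = V⇒≤
    -- An injective `pos` is onto, so the positions 0 and `N` are occupied.
    ; base = let (u , u↦0) = hit Fin.zero
                 (v , v↦N) = hit (fromℕ N)
                 u≡0 = cong toℕ u↦0
                 v≡N = trans (cong toℕ v↦N) (Fin.toℕ-fromℕ N)
             in u , v , u≡0 , v≡N , ends-adjacent u≡0 v≡N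
    ; planar = λ { (_ , _ , refl , refl , ab) (_ , _ , refl , refl , cd) → cross ab cd }
    ; adjacent = λ { (_ , refl) (_ , refl) x<y none → adj⇒E (adjacent x<y λ w → none (w , refl)) }
    }
    where
    hit = injective⇒hit pos (proj₁ (proj₂ outer))

  degree : ∀ {m} → maxDeg G ≤ m → ∀ z → Cov (E z) m
  degree max≤m z with V? z
  ... | no ¬vz = cov-≤ z≤n (cov-∅ λ { (u , _ , p , _) → ¬vz (u , p) })
  ... | yes (u , refl) =
        map at nbrs ,
        ≤-trans (≤-reflexive (trans (length-map at nbrs) (sym (∑-indicator (adj G u) (allFin (suc N))))))
          (≤-trans (≤-max (deg G) (∈-allFin u)) max≤m) ,
        λ { (u′ , v , p , refl , uv) →
              ∈-map⁺ at (∈-filter⁺ nbr? (∈-allFin v) (subst (λ t → Adj G t v) (at-injective p) uv)) }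
    where
    nbr? = λ v → adj G u v Bool.≟ true
    nbrs = filter nbr? (allFin (suc N))

  vertices : Cov V (suc N)
  vertices = map at (allFin (suc N)) ,
    ≤-reflexive (trans (length-map at (allFin (suc N))) (length-tabulate id)) ,
    λ { (u , refl) → ∈-map⁺ at (∈-allFin u) }

-- Choosability of the graph

∧-true : ∀ {b c} → b ∧ c ≡ true → b ≡ true × c ≡ true
∧-true {true} {true} refl = refl , refl

⌊⌋-true : ∀ {A : Set} (a? : Dec A) → ⌊ a? ⌋ ≡ true → A
⌊⌋-true (yes a) _ = a

frugally-choosable : ∀ k → .{{_ : NonZero k}} → ∀ d → 5 ≤ d → ∀ n (G : Graph n) →
  TwoConnected G → Outerplanar G →
  maxDeg G ≤ 2 + d → FrugalChoosable G k (d / k + 3)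
frugally-choosable k d 5≤d zero G (() , _) outer max≤
frugally-choosable k d 5≤d (suc N) G two outer max≤ (L , listed) =
  (λ u → c (at u)) , (λ u → subst (c (at u) ∈_) (L′-at u) (list (u , refl))) ,
  (λ u v uv → proper (adj⇒E uv)) , nbrCount≤k
  where
  open Circle G two outer

  -- Numbers off the circle receive a default list, so that `listed′` holds for every number.
  L′ : ℕ → List ℤ
  L′ z with V? z
  ... | yes (u , _) = L u
  ... | no _ = L Fin.zero

  listed′ : ∀ z → Unique (L′ z) × length (L′ z) ≡ d / k + 3
  listed′ z with V? z
  ... | yes (u , _) = listed u
  ... | no _ = listed Fin.zero

  L′-at : ∀ u → L′ (at u) ≡ L u
  L′-at u with V? (at u)
  ... | yes (v , eq) = cong L (at-injective eq)
  ... | no none = contradiction (u , refl) none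

  open Colour k d 5≤d {N} L′ listed′
  open Colouring (colour (suc N) polygon vertices (degree max≤))

  nbrCount≤k : ∀ v a → nbrCount G (λ u → c (at u)) v a ≤ k
  nbrCount≤k v a = begin
    nbrCount G (λ u → c (at u)) v a    ≡⟨ ∑-indicator b (allFin (suc N)) ⟩
    length l                           ≡⟨ length-map at l ⟨
    length (map at l)                  ≤⟨ frugal (at v) a (map at l)
                                            (Unique.map⁺ at-injective (Unique.filter⁺ b? (Unique.allFin⁺ (suc N)))) mono ⟩
    k                                  ∎
    where
    open ≤-Reasoning
    b : Fin (suc N) → Bool
    b u = adj G v u ∧ ⌊ c (at u) ℤ.≟ a ⌋
    b? = λ u → b u Bool.≟ true
    l = filter b? (allFin (suc N))
    mono : ∀ {z} → z ∈ map at l → E (at v) z × c z ≡ a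
    mono z∈ with u , u∈ , refl ← ∈-map⁻ at z∈
      with vu , same ← ∧-true (proj₂ (∈-filter⁻ b? {xs = allFin (suc N)} u∈)) =
      adj⇒E vu , ⌊⌋-true (c (at u) ℤ.≟ a) same

theorem13 : (k : ℕ) → .{{_ : NonZero k}} → (n : ℕ) → (G : Graph n) →
    TwoConnected G → Outerplanar G → 7 ≤ maxDeg G →
    ChkAtMost G k ((maxDeg G ∸ 2) / k + 3)
theorem13 k n G two outer 7≤Δ = _ , ≤-refl ,
  frugally-choosable k (maxDeg G ∸ 2) (∸-monoˡ-≤ 2 7≤Δ) n G two outer (m≤n+m∸n (maxDeg G) 2)
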